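{- Let $a,b,c$ be nonzero real numbers, let $\{u_n\}$ be the generalized bi-periodic Fibonacci sequence, and let $U=\begin{pmatrix} ab & cb\\ a & 0\end{pmatrix}$. Then for every nonnegative integer $n$, $$U^{n}=(ab)^{\lfloor n/2\rfloor}\begin{pmatrix} b^{\zeta(n)}u_{n+1} & c\,b\,a^{ -\zeta(n+1)}u_{n}\\ a^{\zeta(n)}u_{n} & c\,b^{\zeta(n)}u_{n-1}\end{pmatrix}.$$
   Context: For nonzero real numbers $a,b,c$, the generalized bi-periodic Fibonacci sequence $\{u_n\}$ is defined by $u_0=0$, $u_1=1$ and $u_n=\chi(n)u_{n-1}+c\,u_{n-2}$ for $n\ge 2$, where $\chi(n)=a$ if $n$ is even and $\chi(n)=b$ if $n$ is odd. It is extended to negative indices by the same recurrence run backwards (so $u_{ -1}=1/c$). The parity function is $\zeta(n)=0$ if $n$ is even and $\zeta(n)=1$ if $n$ is odd. -}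

module Defs where

open import Level using (0ℓ)
open import Data.Nat.Base as ℕ using (ℕ; zero; suc)
import Data.Nat.Properties as ℕ
open import Data.Integer.Base as ℤ using (ℤ; +_; -[1+_])
open import Data.Integer.DivMod using (_%ℕ_)
open import Data.Fin.Base using (Fin)
import Data.Fin.Properties as Fin
open import Data.Rational.Base as ℚ using (ℚ; 0ℚ; 1ℚ; ½; ∣_∣)
import Data.Rational.Properties as ℚ
open import Data.Rational.Solver using (module +-*-Solver)
open import Data.Vec.Functional using (Vector; []; _∷_)
open import Data.Bool.Base using (if_then_else_)
open import Data.Product.Base using (∃; ∃-syntax; _×_; _,_; proj₁)
open import Data.Sum.Base as Sum using (_⊎_; inj₁; inj₂)
open import Relation.Nullary using (¬_; yes; no; does; contradiction)
open import Relation.Binary.PropositionalEquality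
  using (_≡_; refl; sym; trans; cong; cong₂; subst; subst₂)
open import Algebra.Structures using (IsCommutativeRing)
open import Algebra.Apartness using (HeytingCommutativeRing; HeytingField; IsHeytingField)
open import Algebra.Definitions using (Invertible)
open import Algebra.Bundles using (CommutativeRing; RawRing)
import Algebra.Definitions.RawSemiring

------------------------------------------------------------------------
-- The field of real numbers: Cauchy sequences of rationals, where two
-- sequences are identified (_≈_) when their difference tends to 0.

module Real where

  open import Data.Rational.Base using (_+_; _*_; -_; _-_; _<_; _≤_)

  Eventually : (ℕ → Set) → Set
  Eventually P = ∃[ N ] ∀ n → N ℕ.≤ n → P n

  Cauchy : (ℕ → ℚ) → Set
  Cauchy x = ∀ ε → 0ℚ < ε →
    ∃[ N ] ∀ m n → N ℕ.≤ m → N ℕ.≤ n → ∣ x m - x n ∣ < ε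

  record ℝ : Set where
    constructor mkℝ
    field
      seq    : ℕ → ℚ
      cauchy : Cauchy seq

  open ℝ public

  infix 4 _≈_ _#_

  _≈_ : ℝ → ℝ → Set
  x ≈ y = ∀ ε → 0ℚ < ε → Eventually λ n → ∣ seq x n - seq y n ∣ < ε

  -- x # y is the positive form of x ≠ y.  It is tight: ¬ (x # y) implies
  -- x ≈ y (see ≈-tight below), so classically it coincides with ¬ (x ≈ y).
  _#_ : ℝ → ℝ → Set
  x # y = ∃[ ε ] 0ℚ < ε × Eventually λ n → ε ≤ ∣ seq x n - seq y n ∣

  private

    infixl 5 _&_
    _&_ : ∀ {P Q : ℕ → Set} →
          Eventually P → Eventually Q → Eventually λ n → P n × Q n
    (M , p) & (N , q) = M ℕ.⊔ N , λ n le →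
      p n (ℕ.≤-trans (ℕ.m≤m⊔n M N) le) , q n (ℕ.≤-trans (ℕ.m≤n⊔m M N) le)

    map : ∀ {P Q : ℕ → Set} → (∀ {n} → P n → Q n) → Eventually P → Eventually Q
    map f (N , p) = N , λ n le → f (p n le)

    some : ∀ {P : ℕ → Set} → Eventually P → ∃ P
    some (N , p) = N , p N ℕ.≤-refl

    half : ∀ {ε} → 0ℚ < ε → 0ℚ < ½ * ε
    half {ε} 0<ε = subst (_< ½ * ε) (ℚ.*-zeroʳ ½) (ℚ.*-monoʳ-<-pos ½ 0<ε)

    half+half : ∀ ε → ½ * ε + ½ * ε ≡ ε
    half+half ε = trans (sym (ℚ.*-distribʳ-+ ε ½ ½)) (ℚ.*-identityˡ ε)

    ∣p-p∣≡0 : ∀ p → ∣ p - p ∣ ≡ 0ℚ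
    ∣p-p∣≡0 p = cong ∣_∣ (ℚ.+-inverseʳ p)

    ∣-∣-sym : ∀ p q → ∣ p - q ∣ ≡ ∣ q - p ∣
    ∣-∣-sym p q = trans (cong ∣_∣ (solve 2 (λ p q → p :- q := :- (q :- p)) refl p q))
                        (ℚ.∣-p∣≡∣p∣ (q - p))
      where open +-*-Solver

    triangle : ∀ p q r → ∣ p - r ∣ ≤ ∣ p - q ∣ + ∣ q - r ∣
    triangle p q r = subst (λ t → ∣ t ∣ ≤ ∣ p - q ∣ + ∣ q - r ∣)
      (solve 3 (λ p q r → (p :- q) :+ (q :- r) := p :- r) refl p q r)
      (ℚ.∣p+q∣≤∣p∣+∣q∣ (p - q) (q - r))
      where open +-*-Solver

    near : ∀ p q r {ε} → ∣ p - q ∣ < ½ * ε → ∣ q - r ∣ < ½ * ε → ∣ p - r ∣ < ε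
    near p q r {ε} h k = ℚ.≤-<-trans (triangle p q r)
      (subst (_ <_) (half+half ε) (ℚ.+-mono-< h k))

    sum-near : ∀ p q p′ q′ {ε} → ∣ p - p′ ∣ < ½ * ε → ∣ q - q′ ∣ < ½ * ε →
               ∣ (p + q) - (p′ + q′) ∣ < ε
    sum-near p q p′ q′ {ε} h k = ℚ.≤-<-trans
      (subst (λ t → ∣ t ∣ ≤ ∣ p - p′ ∣ + ∣ q - q′ ∣)
        (solve 4 (λ p q p′ q′ → (p :- p′) :+ (q :- q′) := (p :+ q) :- (p′ :+ q′))
          refl p q p′ q′)
        (ℚ.∣p+q∣≤∣p∣+∣q∣ (p - p′) (q - q′)))
      (subst (_ <_) (half+half ε) (ℚ.+-mono-< h k))
      where open +-*-Solver

    neg-near : ∀ p q {ε} → ∣ p - q ∣ < ε → ∣ - p - - q ∣ < ε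
    neg-near p q = subst (_< _) (trans (∣-∣-sym p q)
      (cong ∣_∣ (solve 2 (λ p q → q :- p := :- p :- :- q) refl p q)))
      where open +-*-Solver

    quotient : ∀ {B ε} → 0ℚ < B → 0ℚ < ε → ∃[ δ ] 0ℚ < δ × B * δ ≡ ε
    quotient {B} {ε} 0<B 0<ε = 1/B * ε , 0<δ ,
      trans (sym (ℚ.*-assoc B 1/B ε))
        (trans (cong (_* ε) (ℚ.*-inverseʳ B)) (ℚ.*-identityˡ ε))
      where
      instance
        B⁺ = ℚ.positive 0<B
        B≠ = ℚ.pos⇒nonZero B
      1/B = ℚ.1/ B
      0<δ : 0ℚ < 1/B * ε
      0<δ = subst (_< 1/B * ε) (ℚ.*-zeroʳ 1/B)
        (ℚ.*-monoʳ-<-pos 1/B {{ℚ.1/pos⇒pos B}} 0<ε)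

    ∣*∣-≤ : ∀ p q {B C} → 0ℚ < B → ∣ p ∣ ≤ B → ∣ q ∣ ≤ C → ∣ p * q ∣ ≤ B * C
    ∣*∣-≤ p q {B} {C} 0<B h k = subst (_≤ B * C) (sym (ℚ.∣p*q∣≡∣p∣*∣q∣ p q))
      (ℚ.≤-trans (ℚ.*-monoʳ-≤-nonNeg ∣ q ∣ {{ℚ.∣-∣-nonNeg q}} h)
        (ℚ.*-monoˡ-≤-nonNeg B {{ℚ.nonNegative (ℚ.<⇒≤ 0<B)}} k))

    ∣*∣-< : ∀ p q {B δ} → 0ℚ < B → ∣ p ∣ ≤ B → ∣ q ∣ < δ → ∣ p * q ∣ < B * δ
    ∣*∣-< p q {B} {δ} 0<B h k = ℚ.≤-<-trans (∣*∣-≤ p q 0<B h ℚ.≤-refl)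
      (ℚ.*-monoʳ-<-pos B {{ℚ.positive 0<B}} k)

    prod-near : ∀ p q p′ q′ {A B δ η ε} → 0ℚ < A → 0ℚ < B →
                A * δ ≡ ½ * ε → B * η ≡ ½ * ε → ∣ p ∣ ≤ A → ∣ q′ ∣ ≤ B →
                ∣ p - p′ ∣ < η → ∣ q - q′ ∣ < δ → ∣ p * q - p′ * q′ ∣ < ε
    prod-near p q p′ q′ {ε = ε} 0<A 0<B Aδ Bη p≤A q′≤B h k = ℚ.≤-<-trans
      (subst (λ t → ∣ t ∣ ≤ ∣ p * (q - q′) ∣ + ∣ q′ * (p - p′) ∣)
        (solve 4 (λ p q p′ q′ → p :* (q :- q′) :+ q′ :* (p :- p′)
                             := p :* q :- p′ :* q′) refl p q p′ q′)
        (ℚ.∣p+q∣≤∣p∣+∣q∣ (p * (q - q′)) (q′ * (p - p′))))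
      (subst (_ <_) (half+half ε) (ℚ.+-mono-<
        (subst (_ <_) Aδ (∣*∣-< p (q - q′) 0<A p≤A k))
        (subst (_ <_) Bη (∣*∣-< q′ (p - p′) 0<B q′≤B h))))
      where open +-*-Solver

    ≤-of-≤+< : ∀ {ε s t} → ε ≤ s + t → t < ½ * ε → ½ * ε ≤ s
    ≤-of-≤+< {ε} {s} {t} h k with ½ * ε ℚ.≤? s
    ... | yes p = p
    ... | no  p = contradiction
      (ℚ.≤-<-trans h (subst (s + t <_) (half+half ε) (ℚ.+-mono-< (ℚ.≰⇒> p) k)))
      (ℚ.<-irrefl refl)

    bounded : ∀ x → ∃[ B ] 0ℚ < B × Eventually λ n → ∣ seq x n ∣ ≤ B
    bounded x with cauchy x 1ℚ (ℚ.positive⁻¹ 1ℚ)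
    ... | N , h = ∣ seq x N ∣ + 1ℚ
        , ℚ.<-≤-trans (ℚ.positive⁻¹ 1ℚ) (subst (_≤ ∣ seq x N ∣ + 1ℚ) (ℚ.+-identityˡ 1ℚ)
            (ℚ.+-monoˡ-≤ 1ℚ (ℚ.0≤∣p∣ (seq x N))))
        , N , λ n le → ℚ.≤-trans
            (subst (λ t → ∣ t ∣ ≤ ∣ seq x N ∣ + ∣ seq x n - seq x N ∣)
              (solve 2 (λ p q → q :+ (p :- q) := p) refl (seq x n) (seq x N))
              (ℚ.∣p+q∣≤∣p∣+∣q∣ (seq x N) (seq x n - seq x N)))
            (ℚ.+-monoʳ-≤ ∣ seq x N ∣ (ℚ.<⇒≤ (h n N le ℕ.≤-refl)))
      where open +-*-Solver

    pointwise : ∀ {x y} → (∀ n → seq x n ≡ seq y n) → x ≈ y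
    pointwise {x} {y} h ε 0<ε = 0 , λ n _ →
      subst (_< ε) (sym (trans (cong (λ t → ∣ seq x n - t ∣) (sym (h n)))
                               (∣p-p∣≡0 (seq x n)))) 0<ε

  fromℚ : ℚ → ℝ
  fromℚ q = mkℝ (λ _ → q) λ ε 0<ε → 0 , λ _ _ _ _ → subst (_< ε) (sym (∣p-p∣≡0 q)) 0<ε

  0ℝ 1ℝ : ℝ
  0ℝ = fromℚ 0ℚ
  1ℝ = fromℚ 1ℚ

  infixl 6 _+ℝ_
  infixl 7 _*ℝ_
  infix  8 -ℝ_

  _+ℝ_ : ℝ → ℝ → ℝ
  x +ℝ y = mkℝ (λ n → seq x n + seq y n) λ ε 0<ε →
    let M , h = cauchy x (½ * ε) (half 0<ε)
        N , k = cauchy y (½ * ε) (half 0<ε)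
        l = ℕ.m≤m⊔n M N
        r = ℕ.m≤n⊔m M N
    in M ℕ.⊔ N , λ m n m≥ n≥ → sum-near (seq x m) (seq y m) (seq x n) (seq y n)
         (h m n (ℕ.≤-trans l m≥) (ℕ.≤-trans l n≥))
         (k m n (ℕ.≤-trans r m≥) (ℕ.≤-trans r n≥))

  -ℝ_ : ℝ → ℝ
  -ℝ x = mkℝ (λ n → - seq x n) λ ε 0<ε →
    let N , h = cauchy x ε 0<ε
    in N , λ m n m≥ n≥ → neg-near (seq x m) (seq x n) (h m n m≥ n≥)

  _*ℝ_ : ℝ → ℝ → ℝ
  x *ℝ y = mkℝ (λ n → seq x n * seq y n) λ ε 0<ε →
    let A , 0<A , M₁ , p = bounded x
        B , 0<B , M₂ , q = bounded y
        δ , 0<δ , Aδ = quotient 0<A (half 0<ε)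
        η , 0<η , Bη = quotient 0<B (half 0<ε)
        N₁ , h = cauchy x η 0<η
        N₂ , k = cauchy y δ 0<δ
        M = M₁ ℕ.⊔ M₂
        N = N₁ ℕ.⊔ N₂
        l = ℕ.m≤m⊔n M N
        r = ℕ.m≤n⊔m M N
        l₁ = ℕ.≤-trans (ℕ.m≤m⊔n M₁ M₂) l
        l₂ = ℕ.≤-trans (ℕ.m≤n⊔m M₁ M₂) l
        r₁ = ℕ.≤-trans (ℕ.m≤m⊔n N₁ N₂) r
        r₂ = ℕ.≤-trans (ℕ.m≤n⊔m N₁ N₂) r
    in M ℕ.⊔ N , λ m n m≥ n≥ → prod-near (seq x m) (seq y m) (seq x n) (seq y n)
         0<A 0<B Aδ Bη (p m (ℕ.≤-trans l₁ m≥)) (q n (ℕ.≤-trans l₂ n≥))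
         (h m n (ℕ.≤-trans r₁ m≥) (ℕ.≤-trans r₁ n≥))
         (k m n (ℕ.≤-trans r₂ m≥) (ℕ.≤-trans r₂ n≥))

  private

    ≈-refl : ∀ {x} → x ≈ x
    ≈-refl {x} = pointwise {x} {x} λ _ → refl

    ≈-sym : ∀ {x y} → x ≈ y → y ≈ x
    ≈-sym {x} {y} h ε 0<ε =
      map (λ {n} → subst (_< ε) (∣-∣-sym (seq x n) (seq y n))) (h ε 0<ε)

    ≈-trans : ∀ {x y z} → x ≈ y → y ≈ z → x ≈ z
    ≈-trans {x} {y} {z} h k ε 0<ε =
      map (λ {n} (p , q) → near (seq x n) (seq y n) (seq z n) p q)
        (h (½ * ε) (half 0<ε) & k (½ * ε) (half 0<ε))

    +-cong : ∀ {x x′ y y′} → x ≈ x′ → y ≈ y′ → x +ℝ y ≈ x′ +ℝ y′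
    +-cong {x} {x′} {y} {y′} h k ε 0<ε =
      map (λ {n} (p , q) → sum-near (seq x n) (seq y n) (seq x′ n) (seq y′ n) p q)
        (h (½ * ε) (half 0<ε) & k (½ * ε) (half 0<ε))

    -‿cong : ∀ {x y} → x ≈ y → -ℝ x ≈ -ℝ y
    -‿cong {x} {y} h ε 0<ε =
      map (λ {n} → neg-near (seq x n) (seq y n)) (h ε 0<ε)

    *-cong : ∀ {x x′ y y′} → x ≈ x′ → y ≈ y′ → x *ℝ y ≈ x′ *ℝ y′
    *-cong {x} {x′} {y} {y′} h k ε 0<ε =
      let A , 0<A , p = bounded x
          B , 0<B , q = bounded y′
          δ , 0<δ , Aδ = quotient 0<A (half 0<ε)
          η , 0<η , Bη = quotient 0<B (half 0<ε)
      in map (λ {n} (((p , q) , h) , k) →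
                prod-near (seq x n) (seq y n) (seq x′ n) (seq y′ n)
                  0<A 0<B Aδ Bη p q h k)
           (p & q & h η 0<η & k δ 0<δ)

  ℝ-isCommutativeRing : IsCommutativeRing _≈_ _+ℝ_ _*ℝ_ -ℝ_ 0ℝ 1ℝ
  ℝ-isCommutativeRing = record
    { isRing = record
      { +-isAbelianGroup = record
        { isGroup = record
          { isMonoid = record
            { isSemigroup = record
              { isMagma = record
                { isEquivalence = record
                  { refl  = λ {x} → ≈-refl {x}
                  ; sym   = λ {x} {y} → ≈-sym {x} {y}
                  ; trans = λ {x} {y} {z} → ≈-trans {x} {y} {z}
                  }
                ; ∙-cong = λ {x} {x′} {y} {y′} → +-cong {x} {x′} {y} {y′}
                }
              ; assoc = λ x y z → pointwise {x +ℝ y +ℝ z} {x +ℝ (y +ℝ z)}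
                  λ n → ℚ.+-assoc (seq x n) (seq y n) (seq z n)
              }
            ; identity = (λ x → pointwise {0ℝ +ℝ x} {x} λ n → ℚ.+-identityˡ (seq x n))
                       , (λ x → pointwise {x +ℝ 0ℝ} {x} λ n → ℚ.+-identityʳ (seq x n))
            }
          ; inverse = (λ x → pointwise { -ℝ x +ℝ x} {0ℝ} λ n → ℚ.+-inverseˡ (seq x n))
                    , (λ x → pointwise {x +ℝ -ℝ x} {0ℝ} λ n → ℚ.+-inverseʳ (seq x n))
          ; ⁻¹-cong = λ {x} {y} → -‿cong {x} {y}
          }
        ; comm = λ x y → pointwise {x +ℝ y} {y +ℝ x}
            λ n → ℚ.+-comm (seq x n) (seq y n)
        }
      ; *-cong = λ {x} {x′} {y} {y′} → *-cong {x} {x′} {y} {y′}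
      ; *-assoc = λ x y z → pointwise {x *ℝ y *ℝ z} {x *ℝ (y *ℝ z)}
          λ n → ℚ.*-assoc (seq x n) (seq y n) (seq z n)
      ; *-identity = (λ x → pointwise {1ℝ *ℝ x} {x} λ n → ℚ.*-identityˡ (seq x n))
                   , (λ x → pointwise {x *ℝ 1ℝ} {x} λ n → ℚ.*-identityʳ (seq x n))
      ; distrib =
          (λ x y z → pointwise {x *ℝ (y +ℝ z)} {x *ℝ y +ℝ x *ℝ z}
            λ n → ℚ.*-distribˡ-+ (seq x n) (seq y n) (seq z n))
        , (λ x y z → pointwise {(y +ℝ z) *ℝ x} {y *ℝ x +ℝ z *ℝ x}
            λ n → ℚ.*-distribʳ-+ (seq x n) (seq y n) (seq z n))
      }
    ; *-comm = λ x y → pointwise {x *ℝ y} {y *ℝ x}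
        λ n → ℚ.*-comm (seq x n) (seq y n)
    }

  private

    inv : ℚ → ℚ
    inv p with p ℚ.≟ 0ℚ
    ... | yes _  = 0ℚ
    ... | no p≢0 = (ℚ.1/ p) {{ℚ.≢-nonZero p≢0}}

    inv-inverse : ∀ {p ε} → 0ℚ < ε → ε ≤ ∣ p ∣ → inv p * p ≡ 1ℚ
    inv-inverse {p} 0<ε ε≤ with p ℚ.≟ 0ℚ
    ... | yes refl = contradiction (ℚ.<-≤-trans 0<ε ε≤) (ℚ.<-irrefl refl)
    ... | no p≢0   = ℚ.*-inverseˡ p {{ℚ.≢-nonZero p≢0}}

    inv-bound : ∀ {p ε B} → 0ℚ < ε → ε * B ≡ 1ℚ → ε ≤ ∣ p ∣ → ∣ inv p ∣ ≤ B
    inv-bound {p} {ε} {B} 0<ε εB ε≤ = ℚ.*-cancelʳ-≤-pos ε {{ℚ.positive 0<ε}}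
      (ℚ.≤-trans (ℚ.*-monoˡ-≤-nonNeg ∣ inv p ∣ {{ℚ.∣-∣-nonNeg (inv p)}} ε≤)
        (ℚ.≤-reflexive (trans (sym (ℚ.∣p*q∣≡∣p∣*∣q∣ (inv p) p))
          (trans (cong ∣_∣ (inv-inverse 0<ε ε≤)) (trans (sym εB) (ℚ.*-comm ε B))))))

    inv-difference : ∀ p q → inv p * p ≡ 1ℚ → inv q * q ≡ 1ℚ →
                     (inv p * inv q) * (q - p) ≡ inv p - inv q
    inv-difference p q h k = trans
      (solve 4 (λ p p′ q q′ → (p′ :* q′) :* (q :- p)
                           := p′ :* (q′ :* q) :- q′ :* (p′ :* p))
        refl p (inv p) q (inv q))
      (cong₂ _-_ (trans (cong (inv p *_) k) (ℚ.*-identityʳ (inv p)))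
                 (trans (cong (inv q *_) h) (ℚ.*-identityʳ (inv q))))
      where open +-*-Solver

    reciprocal : ∀ x ε → 0ℚ < ε → (Eventually λ n → ε ≤ ∣ seq x n ∣) → ℝ
    reciprocal x ε 0<ε (M , p) = mkℝ (λ n → inv (seq x n)) λ η 0<η →
      let B , 0<B , εB = quotient 0<ε (ℚ.positive⁻¹ 1ℚ)
          0<BB = subst (_< B * B) (ℚ.*-zeroʳ B)
                   (ℚ.*-monoʳ-<-pos B {{ℚ.positive 0<B}} 0<B)
          δ , 0<δ , BBδ = quotient 0<BB 0<η
          N , h = cauchy x δ 0<δ
          l = ℕ.m≤m⊔n M N
          r = ℕ.m≤n⊔m M N
      in M ℕ.⊔ N , λ m n m≥ n≥ →
        let pm = p m (ℕ.≤-trans l m≥)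
            pn = p n (ℕ.≤-trans l n≥)
            s = seq x m
            t = seq x n
        in subst₂ (λ u v → ∣ u ∣ < v)
             (inv-difference s t (inv-inverse 0<ε pm) (inv-inverse 0<ε pn)) BBδ
             (∣*∣-< (inv s * inv t) (t - s) 0<BB
               (∣*∣-≤ (inv s) (inv t) 0<B (inv-bound 0<ε εB pm) (inv-bound 0<ε εB pn))
               (h n m (ℕ.≤-trans r n≥) (ℕ.≤-trans r m≥)))

    #⇒invertible : ∀ {x y} → x # y → Invertible _≈_ 1ℝ _*ℝ_ (x +ℝ -ℝ y)
    #⇒invertible {x} {y} (ε , 0<ε , h) =
      z⁻¹ , left , ≈-trans {z *ℝ z⁻¹} {z⁻¹ *ℝ z} {1ℝ}
        (pointwise {z *ℝ z⁻¹} {z⁻¹ *ℝ z} λ n → ℚ.*-comm (seq z n) (seq z⁻¹ n)) left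
      where
      z   = x +ℝ -ℝ y
      z⁻¹ = reciprocal z ε 0<ε h
      left : z⁻¹ *ℝ z ≈ 1ℝ
      left η 0<η = map (λ {n} k → subst (_< η)
        (sym (trans (cong (λ t → ∣ t - 1ℚ ∣) (inv-inverse {seq z n} 0<ε k))
                    (∣p-p∣≡0 1ℚ))) 0<η) h

    invertible⇒# : ∀ {x y} → Invertible _≈_ 1ℝ _*ℝ_ (x +ℝ -ℝ y) → x # y
    invertible⇒# {x} {y} (w , left , _) =
      let B , 0<B , b = bounded w
          δ , 0<δ , Bδ = quotient 0<B (half (ℚ.positive⁻¹ 1ℚ))
      in δ , 0<δ , map (λ {n} → bound 0<B Bδ (seq w n) (seq x n - seq y n))
                     (b & left ½ (ℚ.positive⁻¹ ½))
      where
      open +-*-Solver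
      bound : ∀ {B δ} → 0ℚ < B → B * δ ≡ ½ * 1ℚ → ∀ p q →
              ∣ p ∣ ≤ B × ∣ p * q - 1ℚ ∣ < ½ → δ ≤ ∣ q ∣
      bound {B} {δ} 0<B Bδ p q (h , k) with δ ℚ.≤? ∣ q ∣
      ... | yes r = r
      ... | no  r = contradiction
        (ℚ.≤-<-trans
          (subst (λ t → ∣ t ∣ ≤ ∣ p * q ∣ + ∣ 1ℚ - p * q ∣)
            (solve 2 (λ s o → s :+ (o :- s) := o) refl (p * q) 1ℚ)
            (ℚ.∣p+q∣≤∣p∣+∣q∣ (p * q) (1ℚ - p * q)))
          (ℚ.+-mono-< (subst (_ <_) Bδ (∣*∣-< p q 0<B h (ℚ.≰⇒> r)))
                      (subst (_< ½) (∣-∣-sym (p * q) 1ℚ) k)))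
        (ℚ.<-irrefl refl)

    #-sym : ∀ {x y} → x # y → y # x
    #-sym {x} {y} (ε , 0<ε , h) =
      ε , 0<ε , map (λ {n} → subst (ε ≤_) (∣-∣-sym (seq x n) (seq y n))) h

    #-irrefl : ∀ {x y} → x ≈ y → ¬ x # y
    #-irrefl h (ε , 0<ε , k) with some (h ε 0<ε & k)
    ... | _ , p , q = ℚ.<-irrefl refl (ℚ.<-≤-trans p q)

    -- For large N, whether x and y are far apart can be read off from their
    -- N-th terms.
    far : ∀ x y {ε} → 0ℚ < ε → ∃[ N ]
          ((ε ≤ ∣ seq x N - seq y N ∣ → x # y) ×
           (∣ seq x N - seq y N ∣ < ε →
             ∀ n → N ℕ.≤ n → ∣ seq x n - seq y n ∣ < ε + ε))
    far x y {ε} 0<ε =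
      let z = x +ℝ -ℝ y
          N , h = cauchy z (½ * ε) (half 0<ε)
          N≤N = ℕ.≤-refl
          term k = seq x k - seq y k
          split : ∀ p q → ∣ p ∣ ≤ ∣ q ∣ + ∣ p - q ∣
          split p q = subst (λ t → ∣ t ∣ ≤ ∣ q ∣ + ∣ p - q ∣)
            (solve 2 (λ p q → q :+ (p :- q) := p) refl p q)
            (ℚ.∣p+q∣≤∣p∣+∣q∣ q (p - q))
          ½ε<ε = subst₂ _<_ (ℚ.+-identityʳ (½ * ε)) (half+half ε)
                   (ℚ.+-monoʳ-< (½ * ε) (half 0<ε))
      in N
       , (λ ε≤ → ½ * ε , half 0<ε , N , λ n le →
            ≤-of-≤+< (ℚ.≤-trans ε≤ (split (term N) (term n))) (h N n N≤N le))
       , (λ <ε n le → ℚ.≤-<-trans (split (term n) (term N))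
            (ℚ.+-mono-< <ε (ℚ.<-trans (h n N le N≤N) ½ε<ε)))
      where open +-*-Solver

    #-or-close : ∀ x y ε → 0ℚ < ε → x # y ⊎ Eventually λ n → ∣ seq x n - seq y n ∣ < ε
    #-or-close x y ε 0<ε =
      let N , apart , close = far x y (half 0<ε)
      in decide (½ * ε) ∣ seq x N - seq y N ∣ apart
           λ <½ε → N , λ n le → subst (_ <_) (half+half ε) (close <½ε n le)
      where
      decide : ∀ {A B : Set} p q → (p ≤ q → A) → (q < p → B) → A ⊎ B
      decide p q f g with p ℚ.≤? q
      ... | yes p≤q = inj₁ (f p≤q)
      ... | no  p≰q = inj₂ (g (ℚ.≰⇒> p≰q))

    #-cotrans : ∀ {x y} → x # y → ∀ z → x # z ⊎ z # y
    #-cotrans {x} {y} (ε , 0<ε , h) z =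
      Sum.map₂ (λ k → ½ * ε , half 0<ε , map (λ {n} → step n) (h & k))
               (#-or-close x z (½ * ε) (half 0<ε))
      where
      step : ∀ n → ε ≤ ∣ seq x n - seq y n ∣ × ∣ seq x n - seq z n ∣ < ½ * ε →
             ½ * ε ≤ ∣ seq z n - seq y n ∣
      step n (p , q) = ≤-of-≤+<
        (ℚ.≤-trans p (subst (∣ seq x n - seq y n ∣ ≤_)
          (ℚ.+-comm ∣ seq x n - seq z n ∣ ∣ seq z n - seq y n ∣)
          (triangle (seq x n) (seq z n) (seq y n)))) q

  ≈-tight : ∀ x y → (¬ x # y → x ≈ y) × (x ≈ y → ¬ x # y)
  ≈-tight x y = from , #-irrefl {x} {y}
    where
    from : ¬ x # y → x ≈ y
    from ¬x#y ε 0<ε = Sum.[ (λ x#y → contradiction x#y ¬x#y) , (λ k → k) ]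
                        (#-or-close x y ε 0<ε)

  ℝ-isHeytingField : IsHeytingField _≈_ _#_ _+ℝ_ _*ℝ_ -ℝ_ 0ℝ 1ℝ
  ℝ-isHeytingField = record
    { isHeytingCommutativeRing = record
      { isCommutativeRing = ℝ-isCommutativeRing
      ; isApartnessRelation = record
        { irrefl  = λ {x} {y} → #-irrefl {x} {y}
        ; sym     = λ {x} {y} → #-sym {x} {y}
        ; cotrans = λ {x} {y} → #-cotrans {x} {y}
        }
      ; #⇒invertible = λ {x} {y} → #⇒invertible {x} {y}
      ; invertible⇒# = λ {x} {y} → invertible⇒# {x} {y}
      }
    ; tight = ≈-tight
    }

-- Opaque because conversion checking becomes intractable once arithmetic is
-- unfolded to Cauchy sequences.
opaque
  ℝ-heytingField : HeytingField 0ℓ 0ℓ 0ℓ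
  ℝ-heytingField = record { isHeytingField = Real.ℝ-isHeytingField }


------------------------------------------------------------------------
-- Integer powers, matrices and the bi-periodic sequence over a field.

ζ : ℤ → ℕ
ζ n = n %ℕ 2

module OverField {c ℓ₁ ℓ₂} (F : HeytingField c ℓ₁ ℓ₂) where

  open HeytingField F

  private
    rawRing = CommutativeRing.rawRing
      (HeytingCommutativeRing.commutativeRing heytingCommutativeRing)

  open Algebra.Definitions.RawSemiring (RawRing.rawSemiring rawRing) public
    using (_^_; sum)

  NonZero : Carrier → Set ℓ₂
  NonZero x = x # 0#

  -- #⇒invertible yields an inverse of x - 0#, which is an inverse of x.
  inverse : ∀ x → NonZero x → Carrier
  inverse x x≠0 = proj₁ (#⇒invertible x≠0)

  power : ∀ x → NonZero x → ℤ → Carrier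
  power x x≠0 (+ n)    = x ^ n
  power x x≠0 -[1+ n ] = inverse x x≠0 ^ suc n

  Matrix : ℕ → ℕ → Set c
  Matrix m n = Vector (Vector Carrier n) m

  infix  4 _≈ᴹ_
  infixl 7 _*ᴹ_ _·ᴹ_
  infixr 8 _^ᴹ_

  _≈ᴹ_ : ∀ {m n} → Matrix m n → Matrix m n → Set ℓ₁
  A ≈ᴹ B = ∀ i j → A i j ≈ B i j

  _*ᴹ_ : ∀ {m n p} → Matrix m n → Matrix n p → Matrix m p
  (A *ᴹ B) i j = sum λ k → A i k * B k j

  _·ᴹ_ : ∀ {m n} → Carrier → Matrix m n → Matrix m n
  (k ·ᴹ A) i j = k * A i j

  1ᴹ : ∀ {n} → Matrix n n
  1ᴹ i j = if does (i Fin.≟ j) then 1# else 0#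

  _^ᴹ_ : ∀ {n} → Matrix n n → ℕ → Matrix n n
  A ^ᴹ zero  = 1ᴹ
  A ^ᴹ suc n = A *ᴹ A ^ᴹ n

  matrix₂ : (p q r s : Carrier) → Matrix 2 2
  matrix₂ p q
          r s = (p ∷ q ∷ [])
              ∷ (r ∷ s ∷ [])
              ∷ []

  module BiperiodicFibonacci (a b c : Carrier) (c≠0 : NonZero c) where

    χ : ℤ → Carrier
    χ n with ζ n
    ... | zero  = a
    ... | suc _ = b

    forward : ℕ → Carrier
    forward 0             = 0#
    forward 1             = 1#
    forward (suc (suc n)) = χ (+ suc (suc n)) * forward (suc n) + c * forward n

    -- backward n is the term of index - n, obtained by solving
    -- u m = χ m * u (m - 1) + c * u (m - 2) for u (m - 2).
    backward : ℕ → Carrier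
    backward 0             = forward 0
    backward 1             = inverse c c≠0 * (forward 1 - χ (+ 1) * backward 0)
    backward (suc (suc n)) =
      inverse c c≠0 * (backward n - χ (ℤ.- + n) * backward (suc n))

    u : ℤ → Carrier
    u (+ n)    = forward n
    u -[1+ n ] = backward (suc n)

{-# OPTIONS --safe #-}
-- Multiplying the claimed closed form of Uⁿ on the left by U gives the one of
-- Uⁿ⁺¹: the second row is a times the previous first row, and the first row is
-- the recurrence for u, read at the indices n + 2 and n + 1, times common
-- factors that depend on the parity of n.
module Submission where

open import Defs
open import Data.Nat.Base using (ℕ; zero; suc; ⌊_/2⌋)
open import Data.Nat.Properties using (+-comm)
open import Data.Integer.Base using (+_) renaming (_+_ to _+ℤ_; _-_ to _-ℤ_; -_ to -ℤ_)
open import Data.Fin.Patterns using (0F; 1F)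
open import Data.Product.Base using (_×_; _,_; proj₂)
open import Data.Sum.Base using (_⊎_; inj₁; inj₂)
open import Relation.Binary.PropositionalEquality as ≡ using (_≡_)
open import Algebra.Apartness using (HeytingField; module HeytingCommutativeRing)
open import Algebra.Bundles using (module CommutativeRing)
import Algebra.Solver.Ring.NaturalCoefficients.Default as Solver
import Algebra.Properties.Ring as RingProperties
import Relation.Binary.Reasoning.Setoid as SetoidReasoning

-- Adding 2 preserves residues modulo 2 by computation, so the induction goes two steps at a time
-- and only the equation between the halves gains a successor.
parity : ∀ n →
  (ζ (+ n) ≡ 0 × ζ (+ suc n) ≡ 1 × ⌊ suc n /2⌋ ≡ ⌊ n /2⌋) ⊎
  (ζ (+ n) ≡ 1 × ζ (+ suc n) ≡ 0 × ⌊ suc n /2⌋ ≡ suc ⌊ n /2⌋)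
parity 0 = inj₁ (≡.refl , ≡.refl , ≡.refl)
parity 1 = inj₂ (≡.refl , ≡.refl , ≡.refl)
parity (suc (suc n)) with parity n
... | inj₁ (e , o , h) = inj₁ (e , o , ≡.cong suc h)
... | inj₂ (o , e , h) = inj₂ (o , e , ≡.cong suc h)

module ClosedForm {r ℓ₁ ℓ₂} (F : HeytingField r ℓ₁ ℓ₂) where

  open HeytingField F using (Carrier; heytingCommutativeRing; #⇒invertible)
  open CommutativeRing
    (HeytingCommutativeRing.commutativeRing heytingCommutativeRing)
    hiding (Carrier)
  open RingProperties ring using (-0#≈0#)
  open OverField F
  open Solver commutativeSemiring using (solve; _:=_; _:+_; _:*_; con)
  open SetoidReasoning setoid

  x-0≈x : ∀ x → x - 0# ≈ x
  x-0≈x x = trans (+-congˡ -0#≈0#) (+-identityʳ x)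

  inverseʳ : ∀ x (x≠0 : NonZero x) → x * inverse x x≠0 ≈ 1#
  inverseʳ x x≠0 = trans (*-congʳ (sym (x-0≈x x))) (proj₂ (proj₂ (#⇒invertible x≠0)))

  module _ (a b c : Carrier) (a≠0 : NonZero a) (c≠0 : NonZero c) where

    open BiperiodicFibonacci a b c c≠0

    U : Matrix 2 2
    U = matrix₂ (a * b) (c * b)
                a       0#

    a⁻¹ : Carrier
    a⁻¹ = inverse a a≠0

    -- To the commutative semiring solver `a⁻¹` is just another variable, so the factor `a * a⁻¹` is
    -- isolated there and removed or inserted here.
    cancel : ∀ x → a * a⁻¹ * x ≈ x
    cancel x = trans (*-congʳ (inverseʳ a a≠0)) (*-identityˡ x)

    χ-even : ∀ n → ζ n ≡ 0 → χ n ≡ a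
    χ-even n eq rewrite eq = ≡.refl

    χ-odd : ∀ n → ζ n ≡ 1 → χ n ≡ b
    χ-odd n eq rewrite eq = ≡.refl

    -- `forward` obeys the recurrence by definition only from index 2 on. Index 1 involves u(-1),
    -- which `backward` obtains by dividing by `c`; multiplying back by `c` gives 1.
    u-suc : ∀ n → u (+ suc n) ≈ χ (+ suc n) * u (+ n) + c * u (+ n -ℤ + 1)
    u-suc zero    = sym (begin
      b * 0# + c * (inverse c c≠0 * (1# - b * 0#)) ≈⟨ +-cong (zeroʳ b) (sym (*-assoc _ _ _)) ⟩
      0# + c * inverse c c≠0 * (1# - b * 0#)       ≈⟨ +-identityˡ _ ⟩
      c * inverse c c≠0 * (1# - b * 0#)            ≈⟨ *-cong (inverseʳ c c≠0) (+-congˡ (-‿cong (zeroʳ b))) ⟩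
      1# * (1# - 0#)                               ≈⟨ *-identityˡ _ ⟩
      1# - 0#                                      ≈⟨ x-0≈x 1# ⟩
      1#                                           ∎)
    u-suc (suc n) = refl

    u-suc-even : ∀ n → ζ (+ suc n) ≡ 0 → u (+ suc n) ≈ a * u (+ n) + c * u (+ n -ℤ + 1)
    u-suc-even n eq = trans (u-suc n) (+-congʳ (*-congʳ (reflexive (χ-even (+ suc n) eq))))

    u-suc-odd : ∀ n → ζ (+ suc n) ≡ 1 → u (+ suc n) ≈ b * u (+ n) + c * u (+ n -ℤ + 1)
    u-suc-odd n eq = trans (u-suc n) (+-congʳ (*-congʳ (reflexive (χ-odd (+ suc n) eq))))

    -- z, z′, y, x, w stand for ζ n, ζ (n + 1), u (n + 1), u n, u (n - 1).
    shape : (h z z′ : ℕ) (y x w : Carrier) → Matrix 2 2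
    shape h z z′ y x w = (a * b) ^ h ·ᴹ
      matrix₂ (b ^ z * y) (c * b * power a a≠0 (-ℤ (+ z′)) * x)
              (a ^ z * x) (c * b ^ z * w)

    *ᴹ-congˡ : ∀ {A B : Matrix 2 2} → A ≈ᴹ B → U *ᴹ A ≈ᴹ U *ᴹ B
    *ᴹ-congˡ A≈B i j = +-cong (*-congˡ (A≈B 0F j)) (+-congʳ (*-congˡ (A≈B 1F j)))

    -- The case of even `n`, with `v` for u(n + 2). The only `a⁻¹`, in the upper right entry, meets
    -- a factor `a` from the first column of `U` and cancels; the power of `a * b` stays the same.
    even-step : ∀ h {v y x w} → v ≈ a * y + c * x → y ≈ b * x + c * w →
                U *ᴹ shape h 0 1 y x w ≈ᴹ shape h 1 0 v y x
    even-step h {v} {y} {x} {w} hv hy = λ where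
        -- The trailing `con 0` closes the two-term `sum`; each `con 1` comes from a power with
        -- exponent 0 or 1.
        0F 0F → trans
          (solve 6 (λ a b c p x y →
            a :* b :* (p :* (con 1 :* y)) :+ (c :* b :* (p :* (con 1 :* x)) :+ con 0) :=
            p :* (b :* con 1 :* (a :* y :+ c :* x))) refl a b c p x y)
          (*-congˡ (*-congˡ (sym hv)))
        0F 1F → begin
          a * b * (p * (c * b * (a⁻¹ * 1#) * x)) + (c * b * (p * (c * 1# * w)) + 0#)
            ≈⟨ solve 7 (λ a i b c p x w →
                 a :* b :* (p :* (c :* b :* (i :* con 1) :* x)) :+
                   (c :* b :* (p :* (c :* con 1 :* w)) :+ con 0) :=
                 p :* (c :* b :* con 1 :* (a :* i :* (b :* x) :+ c :* w)))
                 refl a a⁻¹ b c p x w ⟩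
          p * (c * b * 1# * (a * a⁻¹ * (b * x) + c * w))
            ≈⟨ *-congˡ (*-congˡ (trans (+-congʳ (cancel _)) (sym hy))) ⟩
          p * (c * b * 1# * y) ∎
        1F 0F →
          solve 4 (λ a p x y →
            a :* (p :* (con 1 :* y)) :+ (con 0 :* (p :* (con 1 :* x)) :+ con 0) :=
            p :* (a :* con 1 :* y)) refl a p x y
        1F 1F → trans
          (solve 7 (λ a i b c p x w →
            a :* (p :* (c :* b :* (i :* con 1) :* x)) :+
              (con 0 :* (p :* (c :* con 1 :* w)) :+ con 0) :=
            a :* i :* (p :* (c :* (b :* con 1) :* x))) refl a a⁻¹ b c p x w)
          (cancel _)
      where p = (a * b) ^ h

    -- The case of odd `n`. Every entry now yields one more factor `a * b`, matching the growth of
    -- the halved index.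
    odd-step : ∀ h {v y x w} → v ≈ b * y + c * x → y ≈ a * x + c * w →
               U *ᴹ shape h 1 0 y x w ≈ᴹ shape (suc h) 0 1 v y x
    odd-step h {v} {y} {x} {w} hv hy = λ where
        0F 0F → trans
          (solve 6 (λ a b c p x y →
            a :* b :* (p :* (b :* con 1 :* y)) :+
              (c :* b :* (p :* (a :* con 1 :* x)) :+ con 0) :=
            a :* b :* p :* (con 1 :* (b :* y :+ c :* x))) refl a b c p x y)
          (*-congˡ (*-congˡ (sym hv)))
        0F 1F → begin
          a * b * (p * (c * b * 1# * x)) + (c * b * (p * (c * (b * 1#) * w)) + 0#)
            -- Outside `p` the sum offers a `b` but no `a` for the new `a * b`, so `a * a⁻¹` is
            -- inserted: its `a` completes that factor and its `a⁻¹` is the one in the target entry.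
            ≈⟨ cancel _ ⟨
          a * a⁻¹ * (a * b * (p * (c * b * 1# * x)) + (c * b * (p * (c * (b * 1#) * w)) + 0#))
            ≈⟨ solve 7 (λ a i b c p x w →
                 a :* i :* (a :* b :* (p :* (c :* b :* con 1 :* x)) :+
                   (c :* b :* (p :* (c :* (b :* con 1) :* w)) :+ con 0)) :=
                 a :* b :* p :* (c :* b :* (i :* con 1) :* (a :* x :+ c :* w)))
                 refl a a⁻¹ b c p x w ⟩
          a * b * p * (c * b * (a⁻¹ * 1#) * (a * x + c * w))
            ≈⟨ *-congˡ (*-congˡ (sym hy)) ⟩
          a * b * p * (c * b * (a⁻¹ * 1#) * y) ∎
        1F 0F →
          solve 5 (λ a b p x y →
            a :* (p :* (b :* con 1 :* y)) :+ (con 0 :* (p :* (a :* con 1 :* x)) :+ con 0) :=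
            a :* b :* p :* (con 1 :* y)) refl a b p x y
        1F 1F →
          solve 6 (λ a b c p x w →
            a :* (p :* (c :* b :* con 1 :* x)) :+
              (con 0 :* (p :* (c :* (b :* con 1) :* w)) :+ con 0) :=
            a :* b :* p :* (c :* con 1 :* x)) refl a b c p x w
      where p = (a * b) ^ h

    closed : ℕ → Matrix 2 2
    closed n = shape ⌊ n /2⌋ (ζ (+ n)) (ζ (+ suc n)) (u (+ suc n)) (u (+ n)) (u (+ n -ℤ + 1))

    closed-zero : 1ᴹ ≈ᴹ closed 0
    closed-zero 0F 0F = solve 0 (con 1 := con 1 :* (con 1 :* con 1)) refl
    closed-zero 0F 1F = sym (trans (*-identityˡ _) (zeroʳ _))
    closed-zero 1F 0F = sym (trans (*-identityˡ _) (zeroʳ _))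
    -- This entry asserts that `c` times u(-1) is 1: the recurrence at index 1, where u(0) = 0
    -- removes the term with `b`.
    closed-zero 1F 1F = begin
      1#                                ≈⟨ u-suc 0 ⟩
      b * 0# + c * u (+ 0 -ℤ + 1)       ≈⟨ solve 3 (λ b c w → b :* con 0 :+ c :* w := con 1 :* (c :* con 1 :* w)) refl b c _ ⟩
      1# * (c * 1# * u (+ 0 -ℤ + 1))    ∎

    closed-suc : ∀ n → U *ᴹ closed n ≈ᴹ closed (suc n)
    closed-suc n with parity n
    ... | inj₁ (e , o , h)
      -- `e` concerns `n` but serves for `n + 2`, whose residue computes to the same. Both
      -- recurrences are bound before the rewriting, which then acts on their types as on the goal.
      with hv ← u-suc-even (suc n) e | hy ← u-suc-odd n o
      rewrite e | o | h = even-step ⌊ n /2⌋ hv hy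
    ... | inj₂ (o , e , h)
      with hv ← u-suc-odd (suc n) o | hy ← u-suc-even n e
      rewrite e | o | h = odd-step ⌊ n /2⌋ hv hy

    U^n≈closed : ∀ n → U ^ᴹ n ≈ᴹ closed n
    U^n≈closed zero    = closed-zero
    U^n≈closed (suc n) i j =
      trans (*ᴹ-congˡ (U^n≈closed n) i j) (closed-suc n i j)

open HeytingField ℝ-heytingField using (_*_) renaming (Carrier to ℝ; 0# to 0ℝ)
open OverField ℝ-heytingField

mainTheorem1 :
    (a b c : ℝ) (a≠0 : NonZero a) (b≠0 : NonZero b) (c≠0 : NonZero c) →
    let open BiperiodicFibonacci a b c c≠0
        U = matrix₂ (a * b) (c * b)
                    a       0ℝ
    in (n : ℕ) →
    U ^ᴹ n ≈ᴹ
      (a * b) ^ ⌊ n /2⌋ ·ᴹ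
        matrix₂ (b ^ ζ (+ n) * u (+ n +ℤ + 1))
                (c * b * power a a≠0 (-ℤ (+ ζ (+ n +ℤ + 1))) * u (+ n))
                (a ^ ζ (+ n) * u (+ n))
                (c * b ^ ζ (+ n) * u (+ n -ℤ + 1))
-- `+ n +ℤ + 1` computes to `+ (n + 1)`; commuting the sum turns it into `+ suc n`, the form used in
-- `closed`.
mainTheorem1 a b c a≠0 _ c≠0 n rewrite +-comm n 1 =
  ClosedForm.U^n≈closed ℝ-heytingField a b c a≠0 c≠0 n
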